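{- For every positive integer $n$ there exists a constant $K(n)$, depending only on $n$, such that the following holds for every finite field $\mathbb{F}_q$. Let $A, B, C, D\subseteq M_n(\mathbb{F}_q)$, and let $N$ denote the number of tuples $(a,b,c,d)\in A\times B\times C\times D$ satisfying $a+b=cd$. Then $$ N\leq K(n)\left(\frac{|A||B|^{\frac{1}{2}}|C||D|}{q^{\frac{n^2}{2}}}+q^{n^2-\frac{n+1}{4}}(|A||B||C||D|)^{\frac{1}{2}}\right). $$
   Context: $\mathbb{F}_q$ denotes the finite field with $q$ elements and $M_n(\mathbb{F}_q)$ the ring of $n\times n$ matrices over $\mathbb{F}_q$; $cd$ denotes the matrix product. -}

module Defs where

open import Level using (0ℓ)
open import Data.Nat as ℕ using (ℕ)
open import Data.Fin using (Fin)
open import Data.Vec using (Vec; zipWith; map; foldr; tabulate; lookup)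
open import Data.Vec.Properties using (≡-dec)
open import Data.List as L using (List)
open import Data.Nat.ListAction using (sum)
open import Data.Product using (∃)
open import Relation.Nullary using (¬_; does)
open import Relation.Binary.PropositionalEquality using (_≡_)
open import Relation.Binary.Definitions using (DecidableEquality)
open import Algebra.Structures using (IsCommutativeRing)
open import Function.Bundles using (_↔_)
open import Data.Bool using (if_then_else_)

record FiniteField : Set₁ where
  infixl 6 _+_
  infixl 7 _*_
  field
    Carrier : Set
    _+_ _*_ : Carrier → Carrier → Carrier
    -_      : Carrier → Carrier
    0# 1#   : Carrier
    isCommutativeRing : IsCommutativeRing _≡_ _+_ _*_ -_ 0# 1#
    0≢1     : ¬ (0# ≡ 1#)
    inverse : ∀ x → ¬ (x ≡ 0#) → ∃ λ y → x * y ≡ 1#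
    size    : ℕ
    enum    : Carrier ↔ Fin size
    _≟_     : DecidableEquality Carrier

module _ (F : FiniteField) where
  open FiniteField F

  -- n × n matrices over F (row-major)
  Mat : ℕ → Set
  Mat n = Vec (Vec Carrier n) n

  sumF : ∀ {m} → Vec Carrier m → Carrier
  sumF = foldr _ _+_ 0#

  _+ᴹ_ : ∀ {n} → Mat n → Mat n → Mat n
  a +ᴹ b = zipWith (zipWith _+_) a b

  _*ᴹ_ : ∀ {n} → Mat n → Mat n → Mat n
  c *ᴹ d = tabulate λ i → tabulate λ j →
             sumF (tabulate λ k → lookup (lookup c i) k * lookup (lookup d k) j)

  _≟ᴹ_ : ∀ {n} → DecidableEquality (Mat n)
  _≟ᴹ_ = ≡-dec (≡-dec _≟_)

  countSol : ∀ n → (A B C D : List (Mat n)) → ℕ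
  countSol n A B C D =
    sum (L.map (λ a → sum (L.map (λ b → sum (L.map (λ c → sum (L.map (λ d →
      if does ((a +ᴹ b) ≟ᴹ (c *ᴹ d)) then 1 else 0) D)) C)) B)) A)

{-# OPTIONS --safe #-}
module Submission where

-- Put P = C × (−A), p = |P| and Q = qⁿ².  A solution is a quadruple with c d + e = b, where
-- (c , e) ∈ P; let r(d , b) be the number of such (c , e).  A variance computation and
-- Cauchy–Schwarz over D × B reduce the theorem to bounding the number E of triples (d , w , w′)
-- with w , w′ ∈ P on which (c , e) ↦ c d + e collides, by  qⁿ E ≤ qⁿ p² + Q² p.
--
-- That bound is a Fourier argument without characters.  For a linear form (u , v) on pairs of
-- matrices let S(u , v) ≥ 0 be q times its number of collisions on P, minus p².  Since
-- ⟨v , c d + e⟩ = ⟨v dᵀ , c⟩ + ⟨v , e⟩, the quantity E is governed by Σ_{d,v} S(v dᵀ , v).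
-- For v ≠ 0 a value u = v dᵀ is attained by at most Q / qⁿ matrices d, so this sum is controlled
-- by Σ_{u,v} S(u , v), which only sees the diagonal of P × P.  With |B| ≤ Q, K = 2 suffices.

open import Defs
open import Algebra.Bundles using (CommutativeRing)
import Algebra.Properties.Group as GroupProperties
import Algebra.Properties.Semiring.Sum as SemiringSum
open import Data.Bool using (if_then_else_)
open import Data.Fin using (Fin; zero; suc)
open import Data.List as List using (List; []; _∷_; _++_; length; cartesianProductWith; cartesianProduct; allFin)
open import Data.List.Membership.Propositional using (_∈_)
open import Data.List.Membership.Propositional.Properties using (∈-map⁺; ∈-allFin; ∈-cartesianProductWith⁺; ∈-cartesianProduct⁺)
open import Data.List.Properties using (map-∘; map-++; length-map; length-tabulate; length-++)
open import Data.List.Relation.Unary.All using (All; []; _∷_)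
open import Data.List.Relation.Unary.Any using (here; there)
open import Data.List.Relation.Unary.Unique.Propositional using (Unique; []; _∷_)
open import Data.List.Relation.Unary.Unique.Propositional.Properties using (allFin⁺)
import Data.List.Relation.Unary.Unique.Propositional.Properties as Unique
open import Data.Nat using (ℕ; zero; suc; pred; _≤_; _*_; _^_; _+_; _∸_; z≤n; s≤s; ∣_-_∣; NonZero; >-nonZero)
open import Data.Nat.ListAction using (sum)
open import Data.Nat.ListAction.Properties using (sum-++)
open import Data.Nat.Properties hiding (_≟_)
open import Data.Nat.Tactic.RingSolver using (solve-∀)
open import Data.Product using (Σ; ∃; _×_; _,_; proj₁; proj₂; uncurry)
open import Data.Product.Properties using () renaming (≡-dec to ×-≡-dec)
open import Data.Sum using (_⊎_; inj₁; inj₂)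
open import Data.Vec as Vec using (Vec; []; _∷_; lookup; tabulate; replicate; zipWith)
open import Data.Vec.Properties using (∷-injective; ≡-dec; lookup∘tabulate; lookup-zipWith)
open import Function using (_∘_; id)
open import Function.Bundles using (Inverse)
open import Level using (0ℓ)
open import Relation.Binary.Definitions using (DecidableEquality)
open import Relation.Binary.PropositionalEquality
open import Relation.Nullary using (Dec; yes; no; does; ¬_; contradiction)

private
  variable
    X Y W : Set

-- Sums of natural numbers over lists

∑ : List X → (X → ℕ) → ℕ
∑ xs f = sum (List.map f xs)

∑-cong : ∀ {f g : X → ℕ} → (∀ x → f x ≡ g x) → ∀ xs → ∑ xs f ≡ ∑ xs g
∑-cong eq []       = refl
∑-cong eq (x ∷ xs) = cong₂ _+_ (eq x) (∑-cong eq xs)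

∑-mono : ∀ {f g : X → ℕ} → (∀ x → f x ≤ g x) → ∀ xs → ∑ xs f ≤ ∑ xs g
∑-mono le []       = z≤n
∑-mono le (x ∷ xs) = +-mono-≤ (le x) (∑-mono le xs)

∑-const : ∀ (xs : List X) k → ∑ xs (λ _ → k) ≡ length xs * k
∑-const []       k = refl
∑-const (x ∷ xs) k = cong (k +_) (∑-const xs k)

∑-+ : ∀ (f g : X → ℕ) xs → ∑ xs (λ x → f x + g x) ≡ ∑ xs f + ∑ xs g
∑-+ f g []       = refl
∑-+ f g (x ∷ xs) = trans (cong ((f x + g x) +_) (∑-+ f g xs)) (interchange (f x) (g x) _ _)
  where
  interchange : ∀ a b c d → a + b + (c + d) ≡ a + c + (b + d)
  interchange = solve-∀

∑-*ˡ : ∀ k (f : X → ℕ) xs → ∑ xs (λ x → k * f x) ≡ k * ∑ xs f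
∑-*ˡ k f []       = sym (*-zeroʳ k)
∑-*ˡ k f (x ∷ xs) = trans (cong (k * f x +_) (∑-*ˡ k f xs)) (sym (*-distribˡ-+ k (f x) _))

∑-*ʳ : ∀ k (f : X → ℕ) xs → ∑ xs (λ x → f x * k) ≡ ∑ xs f * k
∑-*ʳ k f []       = refl
∑-*ʳ k f (x ∷ xs) = trans (cong (f x * k +_) (∑-*ʳ k f xs)) (sym (*-distribʳ-+ k (f x) _))

∑-swap : ∀ (f : X → Y → ℕ) xs ys → ∑ xs (λ x → ∑ ys (f x)) ≡ ∑ ys (λ y → ∑ xs (λ x → f x y))
∑-swap f []       ys = sym (trans (∑-const ys 0) (*-zeroʳ (length ys)))
∑-swap f (x ∷ xs) ys = trans (cong (∑ ys (f x) +_) (∑-swap f xs ys)) (sym (∑-+ (f x) _ ys))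

∑-product : ∀ (f : X → ℕ) (g : Y → ℕ) xs ys → ∑ xs f * ∑ ys g ≡ ∑ xs (λ x → ∑ ys (λ y → f x * g y))
∑-product f g xs ys = trans (sym (∑-*ʳ (∑ ys g) f xs)) (∑-cong (λ x → sym (∑-*ˡ (f x) g ys)) xs)

∑-map : ∀ (h : X → Y) (f : Y → ℕ) xs → ∑ (List.map h xs) f ≡ ∑ xs (f ∘ h)
∑-map h f xs = cong sum (sym (map-∘ xs))

∑-++ : ∀ (f : X → ℕ) xs ys → ∑ (xs ++ ys) f ≡ ∑ xs f + ∑ ys f
∑-++ f xs ys = trans (cong sum (map-++ f xs ys)) (sum-++ (List.map f xs) _)

∑-cartesianProductWith : ∀ (h : X → Y → W) (f : W → ℕ) xs ys →
  ∑ (cartesianProductWith h xs ys) f ≡ ∑ xs (λ x → ∑ ys (λ y → f (h x y)))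
∑-cartesianProductWith h f []       ys = refl
∑-cartesianProductWith h f (x ∷ xs) ys =
  trans (∑-++ f (List.map (h x) ys) _)
        (cong₂ _+_ (∑-map (h x) f ys) (∑-cartesianProductWith h f xs ys))

length-cartesianProductWith : ∀ (h : X → Y → W) xs ys →
  length (cartesianProductWith h xs ys) ≡ length xs * length ys
length-cartesianProductWith h []       ys = refl
length-cartesianProductWith h (x ∷ xs) ys =
  trans (length-++ (List.map (h x) ys))
        (cong₂ _+_ (length-map (h x) ys) (length-cartesianProductWith h xs ys))

∈⇒≤∑ : ∀ (f : X → ℕ) {x xs} → x ∈ xs → f x ≤ ∑ xs f
∈⇒≤∑ f (here refl)          = m≤m+n _ _
∈⇒≤∑ f {xs = y ∷ xs} (there x∈xs) = ≤-trans (∈⇒≤∑ f x∈xs) (m≤n+m _ (f y))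

-- The binomial formula for (m - n)², with the cross term moved to the left so that everything stays
-- in ℕ. It feeds both Cauchy-Schwarz and the variance identity.
∣m-n∣²+2mn : ∀ m n → ∣ m - n ∣ * ∣ m - n ∣ + 2 * (m * n) ≡ m * m + n * n
∣m-n∣²+2mn zero    n       = +-identityʳ (n * n)
∣m-n∣²+2mn (suc m) zero    = expand (suc m)
  where
  expand : ∀ k → k * k + 2 * (k * 0) ≡ k * k + 0 * 0
  expand = solve-∀
∣m-n∣²+2mn (suc m) (suc n) = begin
  k * k + 2 * (suc m * suc n)              ≡⟨ shift (k * k) m n ⟩
  k * k + 2 * (m * n) + 2 * (1 + m + n)    ≡⟨ cong (_+ 2 * (1 + m + n)) (∣m-n∣²+2mn m n) ⟩
  m * m + n * n + 2 * (1 + m + n)          ≡⟨ unshift m n ⟩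
  suc m * suc m + suc n * suc n            ∎
  where
  open ≡-Reasoning
  k = ∣ m - n ∣
  shift : ∀ s m n → s + 2 * ((1 + m) * (1 + n)) ≡ s + 2 * (m * n) + 2 * (1 + m + n)
  shift = solve-∀
  unshift : ∀ m n → m * m + n * n + 2 * (1 + m + n) ≡ (1 + m) * (1 + m) + (1 + n) * (1 + n)
  unshift = solve-∀

2mn≤m²+n² : ∀ m n → 2 * (m * n) ≤ m * m + n * n
2mn≤m²+n² m n = ≤-trans (m≤n+m _ (∣ m - n ∣ * ∣ m - n ∣)) (≤-reflexive (∣m-n∣²+2mn m n))

-- Expand the square as a double sum and apply 2 f(x) f(y) ≤ f(x)² + f(y)² to each pair.
cauchy-schwarz : ∀ (f : X → ℕ) xs → ∑ xs f * ∑ xs f ≤ length xs * ∑ xs (λ x → f x * f x)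
cauchy-schwarz f xs = *-cancelˡ-≤ 2 (begin
  2 * (∑ xs f * ∑ xs f)                               ≡⟨ cong (2 *_) (∑-product f f xs xs) ⟩
  2 * ∑ xs (λ x → ∑ xs (λ y → f x * f y))             ≡⟨ ∑-*ˡ 2 _ xs ⟨
  ∑ xs (λ x → 2 * ∑ xs (λ y → f x * f y))             ≡⟨ ∑-cong (λ x → ∑-*ˡ 2 _ xs) xs ⟨
  ∑ xs (λ x → ∑ xs (λ y → 2 * (f x * f y)))           ≤⟨ ∑-mono (λ x → ∑-mono (λ y → 2mn≤m²+n² (f x) (f y)) xs) xs ⟩
  ∑ xs (λ x → ∑ xs (λ y → f x * f x + f y * f y))     ≡⟨ ∑-cong (λ x → trans (∑-+ _ _ xs) (cong (_+ s) (∑-const xs (f x * f x)))) xs ⟩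
  ∑ xs (λ x → length xs * (f x * f x) + s)            ≡⟨ ∑-+ _ _ xs ⟩
  ∑ xs (λ x → length xs * (f x * f x)) + ∑ xs (λ _ → s) ≡⟨ cong₂ _+_ (∑-*ˡ (length xs) _ xs) (∑-const xs s) ⟩
  length xs * s + length xs * s                       ≡⟨ double (length xs * s) ⟩
  2 * (length xs * s)                                 ∎)
  where
  open ≤-Reasoning
  s = ∑ xs (λ x → f x * f x)
  double : ∀ k → k + k ≡ 2 * k
  double = solve-∀

-- Indicators and enumerations

𝟙 : ∀ {P : Set} → Dec P → ℕ
𝟙 p = if does p then 1 else 0

𝟙-yes : ∀ {P : Set} (p : Dec P) → P → 𝟙 p ≡ 1
𝟙-yes (yes _) _  = refl
𝟙-yes (no ¬p) p′ = contradiction p′ ¬p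

𝟙-no : ∀ {P : Set} (p : Dec P) → ¬ P → 𝟙 p ≡ 0
𝟙-no (yes p) ¬p = contradiction p ¬p
𝟙-no (no _)  _  = refl

𝟙≤1 : ∀ {P : Set} (p : Dec P) → 𝟙 p ≤ 1
𝟙≤1 (yes _) = s≤s z≤n
𝟙≤1 (no _)  = z≤n

𝟙-mono : ∀ {P Q : Set} (p : Dec P) (q : Dec Q) → (P → Q) → 𝟙 p ≤ 𝟙 q
𝟙-mono (yes p) q f = ≤-reflexive (sym (𝟙-yes q (f p)))
𝟙-mono (no _)  q f = z≤n

𝟙-cong : ∀ {P Q : Set} (p : Dec P) (q : Dec Q) → (P → Q) → (Q → P) → 𝟙 p ≡ 𝟙 q
𝟙-cong p q f g = ≤-antisym (𝟙-mono p q f) (𝟙-mono q p g)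

𝟙-× : ∀ {P Q R : Set} (p : Dec P) (q : Dec Q) (r : Dec R) → (R → P × Q) → (P → Q → R) → 𝟙 r ≡ 𝟙 p * 𝟙 q
𝟙-× (yes p) (yes q) r f g = 𝟙-yes r (g p q)
𝟙-× (yes p) (no ¬q) r f g = 𝟙-no r (¬q ∘ proj₂ ∘ f)
𝟙-× (no ¬p) q       r f g = 𝟙-no r (¬p ∘ proj₁ ∘ f)

unique⇒count≤1 : (_≟_ : DecidableEquality X) → ∀ {xs} → Unique xs → ∀ y → ∑ xs (λ x → 𝟙 (x ≟ y)) ≤ 1
unique⇒count≤1 _≟_ {[]}     []       y = z≤n
unique⇒count≤1 _≟_ {x ∷ xs} (x∉ ∷ u) y with x ≟ y
... | no  _    = unique⇒count≤1 _≟_ u y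
... | yes refl = s≤s (≤-reflexive (absent x∉))
  where
  absent : ∀ {zs} → All (λ z → ¬ x ≡ z) zs → ∑ zs (λ z → 𝟙 (z ≟ x)) ≡ 0
  absent []             = refl
  absent {z ∷ _} (x≢z ∷ rest) = cong₂ _+_ (𝟙-no (z ≟ x) (x≢z ∘ sym)) (absent rest)

record Enumeration (X : Set) : Set where
  infix 4 _≟_
  field
    _≟_      : DecidableEquality X
    elems    : List X
    unique   : Unique elems
    complete : ∀ x → x ∈ elems

  card : ℕ
  card = length elems

  once : ∀ x → ∑ elems (λ y → 𝟙 (x ≟ y)) ≡ 1
  once x = trans (∑-cong (λ y → 𝟙-cong (x ≟ y) (y ≟ x) sym sym) elems)
    (≤-antisym (unique⇒count≤1 _≟_ unique x)
               (≤-trans (≤-reflexive (sym (𝟙-yes (x ≟ x) refl))) (∈⇒≤∑ (λ y → 𝟙 (y ≟ x)) (complete x))))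

  -- Read from right to left, this inserts a sum over all possible values; swapping sums then groups
  -- terms by value.
  ∑-δ : ∀ (f : X → ℕ) x → ∑ elems (λ y → 𝟙 (x ≟ y) * f y) ≡ f x
  ∑-δ f x = begin
    ∑ elems (λ y → 𝟙 (x ≟ y) * f y) ≡⟨ ∑-cong pointwise elems ⟩
    ∑ elems (λ y → 𝟙 (x ≟ y) * f x) ≡⟨ ∑-*ʳ (f x) _ elems ⟩
    ∑ elems (λ y → 𝟙 (x ≟ y)) * f x ≡⟨ cong (_* f x) (once x) ⟩
    1 * f x                          ≡⟨ *-identityˡ (f x) ⟩
    f x                              ∎
    where
    open ≡-Reasoning
    pointwise : ∀ y → 𝟙 (x ≟ y) * f y ≡ 𝟙 (x ≟ y) * f x
    pointwise y with x ≟ y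
    ... | yes refl = refl
    ... | no  _    = refl

  -- Group the left sum by value: each y contributes f(y) times its multiplicity in `xs`, which is
  -- at most 1.
  ∑-subset : ∀ (f : X → ℕ) {xs} → Unique xs → ∑ xs f ≤ ∑ elems f
  ∑-subset f {xs} u = begin
    ∑ xs f                                              ≡⟨ ∑-cong (λ x → ∑-δ f x) xs ⟨
    ∑ xs (λ x → ∑ elems (λ y → 𝟙 (x ≟ y) * f y))        ≡⟨ ∑-swap _ xs elems ⟩
    ∑ elems (λ y → ∑ xs (λ x → 𝟙 (x ≟ y) * f y))        ≡⟨ ∑-cong (λ y → ∑-*ʳ (f y) _ xs) elems ⟩
    ∑ elems (λ y → ∑ xs (λ x → 𝟙 (x ≟ y)) * f y)        ≤⟨ ∑-mono (λ y → *-monoˡ-≤ (f y) (unique⇒count≤1 _≟_ u y)) elems ⟩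
    ∑ elems (λ y → 1 * f y)                             ≡⟨ ∑-cong (λ y → *-identityˡ (f y)) elems ⟩
    ∑ elems f                                           ∎
    where open ≤-Reasoning

  length-unique≤card : ∀ {xs} → Unique xs → length xs ≤ card
  length-unique≤card {xs} u = begin
    length xs          ≡⟨ *-identityʳ _ ⟨
    length xs * 1      ≡⟨ ∑-const xs 1 ⟨
    ∑ xs (λ _ → 1)     ≤⟨ ∑-subset (λ _ → 1) u ⟩
    ∑ elems (λ _ → 1)  ≡⟨ ∑-const elems 1 ⟩
    card * 1           ≡⟨ *-identityʳ _ ⟩
    card               ∎
    where open ≤-Reasoning

open Enumeration using (elems; card)

×-enumeration : Enumeration X → Enumeration Y → Enumeration (X × Y)
×-enumeration EX EY = record
  { _≟_      = ×-≡-dec EX._≟_ EY._≟_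
  ; elems    = cartesianProduct EX.elems EY.elems
  ; unique   = Unique.cartesianProduct⁺ EX.unique EY.unique
  ; complete = λ (x , y) → ∈-cartesianProduct⁺ (EX.complete x) (EY.complete y)
  }
  where
  module EX = Enumeration EX
  module EY = Enumeration EY

Vec-enumeration : Enumeration X → ∀ m → Enumeration (Vec X m)
Vec-enumeration EX zero = record
  { _≟_ = ≡-dec (Enumeration._≟_ EX) ; elems = [] ∷ [] ; unique = [] ∷ [] ; complete = λ { [] → here refl } }
Vec-enumeration EX (suc m) = record
  { _≟_      = ≡-dec EX._≟_
  ; elems    = cartesianProductWith _∷_ EX.elems Vs.elems
  ; unique   = Unique.cartesianProductWith⁺ _∷_ ∷-injective EX.unique Vs.unique
  ; complete = λ { (x ∷ xs) → ∈-cartesianProductWith⁺ _∷_ (EX.complete x) (Vs.complete xs) }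
  }
  where
  module EX = Enumeration EX
  module Vs = Enumeration (Vec-enumeration EX m)

card-Vec : ∀ (EX : Enumeration X) m → card (Vec-enumeration EX m) ≡ card EX ^ m
card-Vec EX zero    = refl
card-Vec EX (suc m) = trans (length-cartesianProductWith _∷_ (elems EX) _) (cong (card EX *_) (card-Vec EX m))

-- Collisions of a map on a list

module _ (E : Enumeration X) where
  open Enumeration E hiding (elems; card)

  collisions : List W → (W → X) → ℕ
  collisions P g = ∑ P λ w → ∑ P λ w′ → 𝟙 (g w ≟ g w′)

  collisions-cong : ∀ {g h : W → X} → (∀ w → g w ≡ h w) → ∀ P → collisions P g ≡ collisions P h
  collisions-cong eq P = ∑-cong (λ w → ∑-cong (λ w′ → cong₂ (λ x y → 𝟙 (x ≟ y)) (eq w) (eq w′)) P) P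

  fibre : List W → (W → X) → X → ℕ
  fibre P g x = ∑ P λ w → 𝟙 (g w ≟ x)

  ∑-fibre : ∀ (P : List W) g → ∑ (elems E) (fibre P g) ≡ length P
  ∑-fibre P g = begin
    ∑ (elems E) (fibre P g)                        ≡⟨ ∑-swap _ (elems E) P ⟩
    ∑ P (λ w → ∑ (elems E) (λ x → 𝟙 (g w ≟ x)))    ≡⟨ ∑-cong (λ w → once (g w)) P ⟩
    ∑ P (λ _ → 1)                                  ≡⟨ ∑-const P 1 ⟩
    length P * 1                                   ≡⟨ *-identityʳ _ ⟩
    length P                                       ∎
    where open ≡-Reasoning

  -- A square of a fibre size counts the ordered pairs inside that fibre, and every colliding pair
  -- lies in exactly one fibre.
  ∑-fibre² : ∀ (P : List W) g → ∑ (elems E) (λ x → fibre P g x * fibre P g x) ≡ collisions P g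
  ∑-fibre² P g = begin
    ∑ (elems E) (λ x → fibre P g x * fibre P g x)
      ≡⟨ ∑-cong (λ x → ∑-product _ _ P P) (elems E) ⟩
    ∑ (elems E) (λ x → ∑ P λ w → ∑ P λ w′ → 𝟙 (g w ≟ x) * 𝟙 (g w′ ≟ x))
      ≡⟨ ∑-swap _ (elems E) P ⟩
    ∑ P (λ w → ∑ (elems E) λ x → ∑ P λ w′ → 𝟙 (g w ≟ x) * 𝟙 (g w′ ≟ x))
      ≡⟨ ∑-cong (λ w → ∑-swap _ (elems E) P) P ⟩
    ∑ P (λ w → ∑ P λ w′ → ∑ (elems E) λ x → 𝟙 (g w ≟ x) * 𝟙 (g w′ ≟ x))
      ≡⟨ ∑-cong (λ w → ∑-cong (λ w′ → trans (∑-δ (λ x → 𝟙 (g w′ ≟ x)) (g w)) (𝟙-cong (g w′ ≟ g w) (g w ≟ g w′) sym sym)) P) P ⟩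
    collisions P g ∎
    where open ≡-Reasoning

  length²≤card*collisions : ∀ (P : List W) g → length P * length P ≤ card E * collisions P g
  length²≤card*collisions P g = begin
    length P * length P                                            ≡⟨ cong (λ k → k * k) (∑-fibre P g) ⟨
    ∑ (elems E) (fibre P g) * ∑ (elems E) (fibre P g)              ≤⟨ cauchy-schwarz (fibre P g) (elems E) ⟩
    card E * ∑ (elems E) (λ x → fibre P g x * fibre P g x)         ≡⟨ cong (card E *_) (∑-fibre² P g) ⟩
    card E * collisions P g                                        ∎
    where open ≤-Reasoning

  collisions≤length² : ∀ (P : List W) g → collisions P g ≤ length P * length P
  collisions≤length² P g = begin
    collisions P g                 ≤⟨ ∑-mono (λ w → ∑-mono (λ w′ → 𝟙≤1 (g w ≟ g w′)) P) P ⟩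
    ∑ P (λ _ → ∑ P (λ _ → 1))      ≡⟨ ∑-const P _ ⟩
    length P * ∑ P (λ _ → 1)       ≡⟨ cong (length P *_) (trans (∑-const P 1) (*-identityʳ _)) ⟩
    length P * length P            ∎
    where open ≤-Reasoning

  unique⇒collisions≤length : ∀ {P} → Unique P → collisions P id ≤ length P
  unique⇒collisions≤length {P} u = begin
    collisions P id                            ≡⟨ ∑-swap _ P P ⟩
    ∑ P (λ w′ → ∑ P (λ w → 𝟙 (w ≟ w′)))        ≤⟨ ∑-mono (unique⇒count≤1 _≟_ u) P ⟩
    ∑ P (λ _ → 1)                              ≡⟨ trans (∑-const P 1) (*-identityʳ _) ⟩
    length P                                   ∎
    where open ≤-Reasoning

  -- The distance of a fibre size from the mean |P| / |E|, multiplied by |E| to remain a natural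
  -- number.
  deviation : List W → (W → X) → X → ℕ
  deviation P g x = ∣ card E * fibre P g x - length P ∣

  -- The variance identity. Since the fibre sizes r sum to p, the cross term 2Np Σ r of Σ (N r - p)²
  -- equals 2Np², against N p² from the constant terms.
  ∑-deviation² : ∀ (P : List W) g →
    ∑ (elems E) (λ x → deviation P g x * deviation P g x) + card E * (length P * length P)
      ≡ card E * card E * collisions P g
  ∑-deviation² P g = +-cancelʳ-≡ (N * (p * p)) _ _ (begin
    ∑ xs (λ x → dev x * dev x) + N * (p * p) + N * (p * p)
      ≡⟨ regroup (∑ xs λ x → dev x * dev x) N p ⟩
    ∑ xs (λ x → dev x * dev x) + 2 * N * p * p
      ≡⟨ cong (λ k → ∑ xs (λ x → dev x * dev x) + 2 * N * p * k) (∑-fibre P g) ⟨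
    ∑ xs (λ x → dev x * dev x) + 2 * N * p * ∑ xs r
      ≡⟨ cong (∑ xs (λ x → dev x * dev x) +_) (∑-*ˡ (2 * N * p) r xs) ⟨
    ∑ xs (λ x → dev x * dev x) + ∑ xs (λ x → 2 * N * p * r x)
      ≡⟨ ∑-+ _ _ xs ⟨
    ∑ xs (λ x → dev x * dev x + 2 * N * p * r x)
      -- Pointwise this is the expansion of the squared difference of N r(x) and p.
      ≡⟨ ∑-cong (λ x → trans (cong (dev x * dev x +_) (reorder N p (r x)))
                      (trans (∣m-n∣²+2mn (N * r x) p) (cong (_+ p * p) (square N (r x))))) xs ⟩
    ∑ xs (λ x → N * N * (r x * r x) + p * p)
      ≡⟨ ∑-+ _ _ xs ⟩
    ∑ xs (λ x → N * N * (r x * r x)) + ∑ xs (λ _ → p * p)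
      ≡⟨ cong₂ _+_ (trans (∑-*ˡ (N * N) _ xs) (cong (N * N *_) (∑-fibre² P g))) (∑-const xs (p * p)) ⟩
    N * N * collisions P g + N * (p * p) ∎)
    where
    open ≡-Reasoning
    xs  = elems E
    N   = card E
    p   = length P
    r   = fibre P g
    dev = deviation P g
    regroup : ∀ s N p → s + N * (p * p) + N * (p * p) ≡ s + 2 * N * p * p
    regroup = solve-∀
    reorder : ∀ N p r → 2 * N * p * r ≡ 2 * (N * r * p)
    reorder = solve-∀
    square : ∀ N r → N * r * (N * r) ≡ N * N * (r * r)
    square = solve-∀

-- Solving equations entrywise in vectors

module _ {_∙_ _◦_ : X → X → X} {neg : X → X} where

  -- The operations are arbitrary so that two applications lift the cancellation law from scalars to
  -- rows and from rows to matrices.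
  zipWith-solve : (∀ x y z → x ∙ y ≡ z → z ◦ neg x ≡ y) → ∀ {m} (xs ys zs : Vec X m) →
    zipWith _∙_ xs ys ≡ zs → zipWith _◦_ zs (Vec.map neg xs) ≡ ys
  zipWith-solve f []       []       []       eq = refl
  zipWith-solve f (x ∷ xs) (y ∷ ys) (z ∷ zs) eq =
    let eq₀ , eqs = ∷-injective eq in cong₂ _∷_ (f x y z eq₀) (zipWith-solve f xs ys zs eqs)

  zipWith-unsolve : (∀ x y z → z ◦ neg x ≡ y → x ∙ y ≡ z) → ∀ {m} (xs ys zs : Vec X m) →
    zipWith _◦_ zs (Vec.map neg xs) ≡ ys → zipWith _∙_ xs ys ≡ zs
  zipWith-unsolve f []       []       []       eq = refl
  zipWith-unsolve f (x ∷ xs) (y ∷ ys) (z ∷ zs) eq =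
    let eq₀ , eqs = ∷-injective eq in cong₂ _∷_ (f x y z eq₀) (zipWith-unsolve f xs ys zs eqs)

map-injective : ∀ {f : X → Y} → (∀ {x y} → f x ≡ f y → x ≡ y) →
  ∀ {m} {xs ys : Vec X m} → Vec.map f xs ≡ Vec.map f ys → xs ≡ ys
map-injective inj {xs = []}     {[]}     eq = refl
map-injective inj {xs = x ∷ xs} {y ∷ ys} eq =
  let eq₀ , eqs = ∷-injective eq in cong₂ _∷_ (inj eq₀) (map-injective inj eqs)

-- Pairings over a finite field

module Field (F : FiniteField) where
  open FiniteField F using (Carrier; 0#; 1#; -_; isCommutativeRing; inverse; 0≢1; enum)
    renaming (_+_ to _⊕_; _*_ to _⊗_; size to q; _≟_ to _≟ᶠ_)

  ring : CommutativeRing 0ℓ 0ℓ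
  ring = record { isCommutativeRing = isCommutativeRing }

  module R = CommutativeRing ring
  open GroupProperties R.+-group using (∙-cancelʳ; \\-leftDividesˡ; \\-leftDividesʳ; //-rightDividesˡ; ⁻¹-injective)
  open SemiringSum R.semiring using (∑-comm; ∑-distrib-+; *-distribˡ-sum; *-distribʳ-sum; sum-cong-≗)
    renaming (sum to ⨁)

  Fq : Enumeration Carrier
  Fq = record
    { _≟_      = _≟ᶠ_
    ; elems    = List.map (Inverse.from enum) (allFin q)
    ; unique   = Unique.map⁺ (λ eq → trans (sym (Inverse.strictlyInverseˡ enum _))
                                       (trans (cong (Inverse.to enum) eq) (Inverse.strictlyInverseˡ enum _)))
                             (allFin⁺ q)
    ; complete = λ x → subst (_∈ _) (Inverse.strictlyInverseʳ enum x) (∈-map⁺ (Inverse.from enum) (∈-allFin (Inverse.to enum x)))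
    }

  card-Fq : card Fq ≡ q
  card-Fq = trans (length-map _ (allFin q)) (length-tabulate id)

  -- The elements 0 and 1 have different indices. This makes q - 1 cancellable later on.
  2≤q : 2 ≤ q
  2≤q = distinct⇒2≤ (λ eq → 0≢1 (trans (sym (Inverse.strictlyInverseʳ enum 0#))
                                    (trans (cong (Inverse.from enum) eq) (Inverse.strictlyInverseʳ enum 1#))))
    where
    distinct⇒2≤ : ∀ {m} {i j : Fin m} → ¬ i ≡ j → 2 ≤ m
    distinct⇒2≤ {suc zero} {zero} {zero} i≢j = contradiction refl i≢j
    distinct⇒2≤ {suc (suc m)}            i≢j = s≤s (s≤s z≤n)

  instance
    q≢0 : NonZero q
    q≢0 = >-nonZero (≤-trans (s≤s z≤n) 2≤q)

    q-1≢0 : NonZero (pred q)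
    q-1≢0 = >-nonZero (pred-mono-≤ 2≤q)

  Pairing : Set → Set
  Pairing X = X → X → Carrier

  -- For x ≠ y, exactly a 1/q fraction of all v satisfies the equation. The shifts s and t make the
  -- notion inductive: in a direct sum, the contribution of the other summand is absorbed into them.
  Equidistributed : Enumeration X → Pairing X → Set
  Equidistributed E ⟨_,_⟩ = ∀ {x y} → ¬ x ≡ y → ∀ s t →
    q * ∑ (elems E) (λ v → 𝟙 ((s ⊕ ⟨ v , x ⟩) ≟ᶠ (t ⊕ ⟨ v , y ⟩))) ≡ card E

  -- The equation is linear in v with leading coefficient x - y ≠ 0, so it has the single root (t -
  -- s) / (x - y).
  ⊗-equidistributed : Equidistributed Fq _⊗_
  ⊗-equidistributed {x} {y} x≢y s t = begin
    q * ∑ (elems Fq) (λ v → 𝟙 ((s ⊕ v ⊗ x) ≟ᶠ (t ⊕ v ⊗ y))) ≡⟨ cong (q *_) (∑-cong (λ v → 𝟙-cong (_ ≟ᶠ _) (v₀ ≟ᶠ v) solution-unique is-solution) (elems Fq)) ⟩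
    q * ∑ (elems Fq) (λ v → 𝟙 (v₀ ≟ᶠ v))                    ≡⟨ cong (q *_) (Enumeration.once Fq v₀) ⟩
    q * 1                                                   ≡⟨ *-identityʳ q ⟩
    q                                                       ≡⟨ card-Fq ⟨
    card Fq                                                 ∎
    where
    open ≡-Reasoning
    w = x ⊕ - y
    w⊕y≡x : w ⊕ y ≡ x
    w⊕y≡x = //-rightDividesˡ y x
    w⁻¹ : ∃ λ z → w ⊗ z ≡ 1#
    w⁻¹ = inverse w λ w≡0 → x≢y (trans (sym w⊕y≡x) (trans (cong (_⊕ y) w≡0) (R.+-identityˡ y)))
    z = proj₁ w⁻¹
    v₀ = (- s ⊕ t) ⊗ z
    split : ∀ v → s ⊕ v ⊗ x ≡ (s ⊕ v ⊗ w) ⊕ v ⊗ y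
    split v = trans (cong (λ k → s ⊕ v ⊗ k) (sym w⊕y≡x)) (trans (cong (s ⊕_) (R.distribˡ v w y)) (sym (R.+-assoc s _ _)))
    v₀⊗w : v₀ ⊗ w ≡ - s ⊕ t
    v₀⊗w = trans (R.*-assoc _ z w) (trans (cong ((- s ⊕ t) ⊗_) (trans (R.*-comm z w) (proj₂ w⁻¹))) (R.*-identityʳ _))
    solution-unique : ∀ {v} → s ⊕ v ⊗ x ≡ t ⊕ v ⊗ y → v₀ ≡ v
    solution-unique {v} eq = begin
      (- s ⊕ t) ⊗ z                 ≡⟨ cong (λ k → (- s ⊕ k) ⊗ z) (∙-cancelʳ (v ⊗ y) _ _ (trans (sym (split v)) eq)) ⟨
      (- s ⊕ (s ⊕ v ⊗ w)) ⊗ z       ≡⟨ cong (_⊗ z) (\\-leftDividesʳ s (v ⊗ w)) ⟩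
      v ⊗ w ⊗ z                     ≡⟨ R.*-assoc v w z ⟩
      v ⊗ (w ⊗ z)                   ≡⟨ cong (v ⊗_) (proj₂ w⁻¹) ⟩
      v ⊗ 1#                        ≡⟨ R.*-identityʳ v ⟩
      v                             ∎
    is-solution : ∀ {v} → v₀ ≡ v → s ⊕ v ⊗ x ≡ t ⊕ v ⊗ y
    is-solution refl = trans (split v₀) (cong (_⊕ v₀ ⊗ y) (trans (cong (s ⊕_) v₀⊗w) (\\-leftDividesˡ s t)))

  module _ {EX : Enumeration X} {EY : Enumeration Y} {⟨_,_⟩ˣ : Pairing X} {⟨_,_⟩ʸ : Pairing Y}
           (equiˣ : Equidistributed EX ⟨_,_⟩ˣ) (equiʸ : Equidistributed EY ⟨_,_⟩ʸ) where

    -- At least one coordinate differs. Fix the variable paired with the other coordinate, move its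
    -- terms into the shifts, and sum over the remaining variable first. The double sum serves both
    -- pairs and vectors split into head and tail.
    ∑-equidistributed : ∀ {x y x′ y′} → ¬ (x ≡ x′ × y ≡ y′) → ∀ s t →
      q * ∑ (elems EX) (λ v → ∑ (elems EY) λ w →
            𝟙 ((s ⊕ (⟨ v , x ⟩ˣ ⊕ ⟨ w , y ⟩ʸ)) ≟ᶠ (t ⊕ (⟨ v , x′ ⟩ˣ ⊕ ⟨ w , y′ ⟩ʸ))))
        ≡ card EX * card EY
    ∑-equidistributed {x} {y} {x′} {y′} ≢ s t with Enumeration._≟_ EX x x′
    ... | yes x≡x′ = begin
      q * ∑ (elems EX) (λ v → ∑ (elems EY) λ w → h v w)
        ≡⟨ ∑-*ˡ q _ (elems EX) ⟨
      ∑ (elems EX) (λ v → q * ∑ (elems EY) λ w → h v w)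
        ≡⟨ ∑-cong (λ v → trans
             (cong (q *_) (∑-cong (λ w → cong₂ (λ a b → 𝟙 (a ≟ᶠ b)) (sym (R.+-assoc s _ _)) (sym (R.+-assoc t _ _))) (elems EY)))
             (equiʸ (λ y≡y′ → ≢ (x≡x′ , y≡y′)) (s ⊕ ⟨ v , x ⟩ˣ) (t ⊕ ⟨ v , x′ ⟩ˣ))) (elems EX) ⟩
      ∑ (elems EX) (λ _ → card EY)
        ≡⟨ ∑-const (elems EX) _ ⟩
      card EX * card EY ∎
      where
      open ≡-Reasoning
      h = λ v w → 𝟙 ((s ⊕ (⟨ v , x ⟩ˣ ⊕ ⟨ w , y ⟩ʸ)) ≟ᶠ (t ⊕ (⟨ v , x′ ⟩ˣ ⊕ ⟨ w , y′ ⟩ʸ)))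
    ... | no x≢x′ = begin
      q * ∑ (elems EX) (λ v → ∑ (elems EY) λ w → h v w)
        ≡⟨ cong (q *_) (∑-swap h (elems EX) (elems EY)) ⟩
      q * ∑ (elems EY) (λ w → ∑ (elems EX) λ v → h v w)
        ≡⟨ ∑-*ˡ q _ (elems EY) ⟨
      ∑ (elems EY) (λ w → q * ∑ (elems EX) λ v → h v w)
        ≡⟨ ∑-cong (λ w → trans
             (cong (q *_) (∑-cong (λ v → cong₂ (λ a b → 𝟙 (a ≟ᶠ b)) (rotate s _ _) (rotate t _ _)) (elems EX)))
             (equiˣ x≢x′ (s ⊕ ⟨ w , y ⟩ʸ) (t ⊕ ⟨ w , y′ ⟩ʸ))) (elems EY) ⟩
      ∑ (elems EY) (λ _ → card EX)
        ≡⟨ ∑-const (elems EY) _ ⟩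
      card EY * card EX
        ≡⟨ *-comm (card EY) (card EX) ⟩
      card EX * card EY ∎
      where
      open ≡-Reasoning
      h = λ v w → 𝟙 ((s ⊕ (⟨ v , x ⟩ˣ ⊕ ⟨ w , y ⟩ʸ)) ≟ᶠ (t ⊕ (⟨ v , x′ ⟩ˣ ⊕ ⟨ w , y′ ⟩ʸ)))
      rotate : ∀ a b c → a ⊕ (b ⊕ c) ≡ a ⊕ c ⊕ b
      rotate a b c = trans (cong (a ⊕_) (R.+-comm b c)) (sym (R.+-assoc a c b))

    ×-equidistributed : Equidistributed (×-enumeration EX EY) (λ (u , v) (x , y) → ⟨ u , x ⟩ˣ ⊕ ⟨ v , y ⟩ʸ)
    ×-equidistributed ≢ s t = trans
      (cong (q *_) (∑-cartesianProductWith _,_ _ (elems EX) (elems EY)))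
      (trans (∑-equidistributed (λ (x≡ , y≡) → ≢ (cong₂ _,_ x≡ y≡)) s t)
             (sym (length-cartesianProductWith _,_ (elems EX) (elems EY))))

  -- How far the collision count of f is above its minimum |P|² / q, scaled by q.
  excess : List W → (W → Carrier) → ℕ
  excess P f = q * collisions Fq P f ∸ length P * length P

  -- The truncated subtraction in `excess` loses nothing, because Cauchy-Schwarz gives |P|² ≤ q
  -- times the collision count.
  excess+length² : ∀ (P : List W) f → excess P f + length P * length P ≡ q * collisions Fq P f
  excess+length² P f = m∸n+n≡m (subst (λ k → length P * length P ≤ k * collisions Fq P f) card-Fq
                                      (length²≤card*collisions Fq P f))

  excess≤ : ∀ (P : List W) f → excess P f ≤ pred q * (length P * length P)
  excess≤ P f = begin
    q * collisions Fq P f ∸ p²  ≤⟨ ∸-monoˡ-≤ p² (*-monoʳ-≤ q (collisions≤length² Fq P f)) ⟩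
    q * p² ∸ p²                 ≡⟨ cong (λ k → k * p² ∸ p²) (suc-pred q) ⟨
    p² + pred q * p² ∸ p²       ≡⟨ m+n∸m≡n p² (pred q * p²) ⟩
    pred q * p²                 ∎
    where
    open ≤-Reasoning
    p² = length P * length P

  -- Averaging over all linear forms

  module _ {E : Enumeration X} {⟨_,_⟩ : Pairing X} (equi : Equidistributed E ⟨_,_⟩) where
    open Enumeration E using (_≟_)

    -- The orthogonality relation: every v identifies x with itself, and a 1/q fraction of them
    -- identifies distinct x and y. The term with q - 1 is the surplus on the diagonal.
    ∑-pairing-collision : ∀ x y →
      q * ∑ (elems E) (λ v → 𝟙 (⟨ v , x ⟩ ≟ᶠ ⟨ v , y ⟩)) ≡ card E + pred q * (card E * 𝟙 (x ≟ y))
    ∑-pairing-collision x y with x ≟ y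
    ... | yes refl = begin
      q * ∑ (elems E) (λ v → 𝟙 (⟨ v , x ⟩ ≟ᶠ ⟨ v , x ⟩))
        ≡⟨ cong (q *_) (trans (∑-cong (λ v → 𝟙-yes (_ ≟ᶠ _) refl) (elems E)) (∑-const (elems E) 1)) ⟩
      q * (card E * 1)
        ≡⟨ cong (_* (card E * 1)) (suc-pred q) ⟨
      card E * 1 + pred q * (card E * 1)
        ≡⟨ cong (_+ pred q * (card E * 1)) (*-identityʳ (card E)) ⟩
      card E + pred q * (card E * 1) ∎
      where open ≡-Reasoning
    ... | no x≢y = begin
      q * ∑ (elems E) (λ v → 𝟙 (⟨ v , x ⟩ ≟ᶠ ⟨ v , y ⟩))
        ≡⟨ cong (q *_) (∑-cong (λ v → cong₂ (λ a b → 𝟙 (a ≟ᶠ b)) (sym (R.+-identityˡ _)) (sym (R.+-identityˡ _))) (elems E)) ⟩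
      q * ∑ (elems E) (λ v → 𝟙 ((0# ⊕ ⟨ v , x ⟩) ≟ᶠ (0# ⊕ ⟨ v , y ⟩)))
        ≡⟨ equi x≢y 0# 0# ⟩
      card E
        ≡⟨ +-identityʳ (card E) ⟨
      card E + 0
        ≡⟨ cong (card E +_) (*-zeroʳ (pred q)) ⟨
      card E + pred q * 0
        ≡⟨ cong (λ k → card E + pred q * k) (*-zeroʳ (card E)) ⟨
      card E + pred q * (card E * 0) ∎
      where open ≡-Reasoning

    ∑-collisions : ∀ (P : List W) g →
      q * ∑ (elems E) (λ v → collisions Fq P (λ w → ⟨ v , g w ⟩))
        ≡ pred q * (card E * collisions E P g) + card E * (length P * length P)
    ∑-collisions P g = begin
      q * ∑ (elems E) (λ v → ∑ P λ w → ∑ P λ w′ → h v w w′)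
        ≡⟨ cong (q *_) (trans (∑-swap _ (elems E) P) (∑-cong (λ w → ∑-swap _ (elems E) P) P)) ⟩
      q * ∑ P (λ w → ∑ P λ w′ → ∑ (elems E) λ v → h v w w′)
        ≡⟨ trans (sym (∑-*ˡ q _ P)) (∑-cong (λ w → sym (∑-*ˡ q _ P)) P) ⟩
      ∑ P (λ w → ∑ P λ w′ → q * ∑ (elems E) λ v → h v w w′)
        ≡⟨ ∑-cong (λ w → ∑-cong (λ w′ → ∑-pairing-collision (g w) (g w′)) P) P ⟩
      ∑ P (λ w → ∑ P λ w′ → card E + pred q * (card E * 𝟙 (g w ≟ g w′)))
        ≡⟨ trans (∑-cong (λ w → trans (∑-+ _ _ P) (cong₂ _+_ (∑-const P (card E)) (∑-**ˡ (pred q) (card E) _ P))) P) (∑-+ _ _ P) ⟩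
      ∑ P (λ _ → length P * card E) + ∑ P (λ w → pred q * (card E * ∑ P λ w′ → 𝟙 (g w ≟ g w′)))
        ≡⟨ cong₂ _+_ (∑-const P _) (∑-**ˡ (pred q) (card E) _ P) ⟩
      length P * (length P * card E) + pred q * (card E * collisions E P g)
        ≡⟨ rearrange (length P) (card E) _ ⟩
      pred q * (card E * collisions E P g) + card E * (length P * length P) ∎
      where
      open ≡-Reasoning
      h = λ v w w′ → 𝟙 (⟨ v , g w ⟩ ≟ᶠ ⟨ v , g w′ ⟩)
      ∑-**ˡ : ∀ a b (f : W → ℕ) xs → ∑ xs (λ x → a * (b * f x)) ≡ a * (b * ∑ xs f)
      ∑-**ˡ a b f xs = trans (∑-*ˡ a _ xs) (cong (a *_) (∑-*ˡ b f xs))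
      rearrange : ∀ p e c → p * (p * e) + c ≡ c + e * (p * p)
      rearrange = solve-∀

    -- Plancherel's identity, with characters grouped by their kernels.
    ∑-excess : ∀ (P : List W) g →
      ∑ (elems E) (λ v → excess P (λ w → ⟨ v , g w ⟩)) ≡ pred q * (card E * collisions E P g)
    ∑-excess P g = +-cancelʳ-≡ (card E * (length P * length P)) _ _ (begin
      ∑ (elems E) (λ v → excess P (λ w → ⟨ v , g w ⟩)) + card E * (length P * length P)
        ≡⟨ cong (∑ (elems E) (λ v → excess P (λ w → ⟨ v , g w ⟩)) +_) (∑-const (elems E) _) ⟨
      ∑ (elems E) (λ v → excess P (λ w → ⟨ v , g w ⟩)) + ∑ (elems E) (λ _ → length P * length P)
        ≡⟨ ∑-+ _ _ (elems E) ⟨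
      ∑ (elems E) (λ v → excess P (λ w → ⟨ v , g w ⟩) + length P * length P)
        ≡⟨ ∑-cong (λ v → excess+length² P (λ w → ⟨ v , g w ⟩)) (elems E) ⟩
      ∑ (elems E) (λ v → q * collisions Fq P (λ w → ⟨ v , g w ⟩))
        ≡⟨ ∑-*ˡ q _ (elems E) ⟩
      q * ∑ (elems E) (λ v → collisions Fq P (λ w → ⟨ v , g w ⟩))
        ≡⟨ ∑-collisions P g ⟩
      pred q * (card E * collisions E P g) + card E * (length P * length P) ∎)
      where open ≡-Reasoning

  -- Built over any pairing of the entries, so that iterating it passes from scalars to rows and
  -- then to matrices.
  dot : Pairing X → ∀ {m} → Pairing (Vec X m)
  dot ⟨_,_⟩ v x = sumF F (tabulate λ i → ⟨ lookup v i , lookup x i ⟩)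

  dot-equidistributed : ∀ {E : Enumeration X} {⟨_,_⟩ : Pairing X} → Equidistributed E ⟨_,_⟩ →
    ∀ m → Equidistributed (Vec-enumeration E m) (dot ⟨_,_⟩)
  dot-equidistributed equi zero {[]} {[]} ≢ s t = contradiction refl ≢
  dot-equidistributed {E = E} equi (suc m) {x ∷ xs} {y ∷ ys} ≢ s t = trans
    (cong (q *_) (∑-cartesianProductWith _∷_ _ (elems E) (elems (Vec-enumeration E m))))
    (trans (∑-equidistributed {EX = E} {EY = Vec-enumeration E m} equi (dot-equidistributed {E = E} equi m) (λ (x≡ , xs≡) → ≢ (cong₂ _∷_ x≡ xs≡)) s t)
           (sym (length-cartesianProductWith _∷_ (elems E) (elems (Vec-enumeration E m)))))

  -- Passes to the library's sum over `Fin m`, for which distributivity and exchange of sums are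
  -- available.
  sumF-tabulate : ∀ {m} (f : Fin m → Carrier) → sumF F (tabulate f) ≡ ⨁ f
  sumF-tabulate {zero}  f = refl
  sumF-tabulate {suc m} f = cong (f zero ⊕_) (sumF-tabulate (f ∘ suc))

  dot-⨁ : ∀ (⟨_,_⟩ : Pairing X) {m} (v x : Vec X m) → dot ⟨_,_⟩ v x ≡ ⨁ (λ i → ⟨ lookup v i , lookup x i ⟩)
  dot-⨁ ⟨_,_⟩ v x = sumF-tabulate (λ i → ⟨ lookup v i , lookup x i ⟩)

  dot-zipWith : ∀ {⟨_,_⟩ : Pairing X} {_∙_ : X → X → X} → (∀ v x y → ⟨ v , x ∙ y ⟩ ≡ ⟨ v , x ⟩ ⊕ ⟨ v , y ⟩) →
    ∀ {m} (v x y : Vec X m) → dot ⟨_,_⟩ v (zipWith _∙_ x y) ≡ dot ⟨_,_⟩ v x ⊕ dot ⟨_,_⟩ v y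
  dot-zipWith {⟨_,_⟩ = ⟨_,_⟩} {_∙_} distrib v x y = begin
    dot ⟨_,_⟩ v (zipWith _∙_ x y)
      ≡⟨ dot-⨁ ⟨_,_⟩ v (zipWith _∙_ x y) ⟩
    ⨁ (λ i → ⟨ lookup v i , lookup (zipWith _∙_ x y) i ⟩)
      ≡⟨ sum-cong-≗ (λ i → trans (cong ⟨ lookup v i ,_⟩ (lookup-zipWith _∙_ i x y)) (distrib _ _ _)) ⟩
    ⨁ (λ i → ⟨ lookup v i , lookup x i ⟩ ⊕ ⟨ lookup v i , lookup y i ⟩)
      ≡⟨ ∑-distrib-+ (λ i → ⟨ lookup v i , lookup x i ⟩) (λ i → ⟨ lookup v i , lookup y i ⟩) ⟩
    ⨁ (λ i → ⟨ lookup v i , lookup x i ⟩) ⊕ ⨁ (λ i → ⟨ lookup v i , lookup y i ⟩)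
      ≡⟨ cong₂ _⊕_ (dot-⨁ ⟨_,_⟩ v x) (dot-⨁ ⟨_,_⟩ v y) ⟨
    dot ⟨_,_⟩ v x ⊕ dot ⟨_,_⟩ v y ∎
    where open ≡-Reasoning

  -- The trace form on matrices and the adjoint of right multiplication

  Row : ∀ n → Enumeration (Vec Carrier n)
  Row n = Vec-enumeration Fq n

  _·_ : ∀ {n} → Pairing (Vec Carrier n)
  _·_ = dot _⊗_

  -- The trace form tr(v xᵀ), that is, the sum of the products of corresponding entries.
  ⟪_,_⟫ : ∀ {n} → Pairing (Mat F n)
  ⟪_,_⟫ = dot _·_

  -- v *ᵀ d is v dᵀ
  _*ᵀ_ : ∀ {n} → Mat F n → Mat F n → Mat F n
  v *ᵀ d = tabulate λ i → tabulate λ k → lookup d k · lookup v i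

  -- One row of the matrix identity: both sides are the double sum of v_j c_k d_kj, taken in the two
  -- orders.
  ·-adjoint : ∀ {m n} (v : Vec Carrier n) (c : Vec Carrier m) (d : Vec (Vec Carrier n) m) →
    v · (tabulate λ j → sumF F (tabulate λ k → lookup c k ⊗ lookup (lookup d k) j))
      ≡ (tabulate λ k → lookup d k · v) · c
  ·-adjoint v c d = begin
    v · tabulate cd
      ≡⟨ dot-⨁ _⊗_ v (tabulate cd) ⟩
    ⨁ (λ j → lookup v j ⊗ lookup (tabulate cd) j)
      ≡⟨ sum-cong-≗ (λ j → trans
           (cong (lookup v j ⊗_) (trans (lookup∘tabulate cd j) (sumF-tabulate (λ k → lookup c k ⊗ lookup (lookup d k) j))))
           (*-distribˡ-sum (lookup v j) (λ k → lookup c k ⊗ lookup (lookup d k) j))) ⟩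
    ⨁ (λ j → ⨁ λ k → lookup v j ⊗ (lookup c k ⊗ lookup (lookup d k) j))
      ≡⟨ ∑-comm (λ j k → lookup v j ⊗ (lookup c k ⊗ lookup (lookup d k) j)) ⟩
    ⨁ (λ k → ⨁ λ j → lookup v j ⊗ (lookup c k ⊗ lookup (lookup d k) j))
      ≡⟨ sum-cong-≗ (λ k → sum-cong-≗ λ j → rotate (lookup v j) (lookup c k) (lookup (lookup d k) j)) ⟩
    ⨁ (λ k → ⨁ λ j → (lookup (lookup d k) j ⊗ lookup v j) ⊗ lookup c k)
      ≡⟨ sum-cong-≗ (λ k → trans
           (sym (*-distribʳ-sum (lookup c k) (λ j → lookup (lookup d k) j ⊗ lookup v j)))
           (cong (_⊗ lookup c k) (trans (sym (dot-⨁ _⊗_ (lookup d k) v)) (sym (lookup∘tabulate dv k))))) ⟩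
    ⨁ (λ k → lookup (tabulate dv) k ⊗ lookup c k)
      ≡⟨ dot-⨁ _⊗_ (tabulate dv) c ⟨
    tabulate dv · c ∎
    where
    open ≡-Reasoning
    cd = λ j → sumF F (tabulate λ k → lookup c k ⊗ lookup (lookup d k) j)
    dv = λ k → lookup d k · v
    rotate : ∀ a b c → a ⊗ (b ⊗ c) ≡ (c ⊗ a) ⊗ b
    rotate a b c = trans (cong (a ⊗_) (R.*-comm b c)) (trans (sym (R.*-assoc a c b)) (cong (_⊗ b) (R.*-comm a c)))

  ⟪⟫-adjoint : ∀ {n} (v c d : Mat F n) → ⟪ v , _*ᴹ_ F c d ⟫ ≡ ⟪ v *ᵀ d , c ⟫
  ⟪⟫-adjoint v c d = begin
    ⟪ v , _*ᴹ_ F c d ⟫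
      ≡⟨ dot-⨁ _·_ v (_*ᴹ_ F c d) ⟩
    ⨁ (λ i → lookup v i · lookup (_*ᴹ_ F c d) i)
      ≡⟨ sum-cong-≗ (λ i → trans (cong (lookup v i ·_) (lookup∘tabulate _ i))
           (trans (·-adjoint (lookup v i) (lookup c i) d) (cong (_· lookup c i) (sym (lookup∘tabulate _ i))))) ⟩
    ⨁ (λ i → lookup (v *ᵀ d) i · lookup c i)
      ≡⟨ dot-⨁ _·_ (v *ᵀ d) c ⟨
    ⟪ v *ᵀ d , c ⟫ ∎
    where open ≡-Reasoning

  -- Testing c d + e against v gives a linear form in (c , e) with coefficients (v dᵀ , v); this
  -- connects the collisions of the affine maps with forms on pairs.
  ⟪⟫-affine : ∀ {n} (v c d e : Mat F n) → ⟪ v , _+ᴹ_ F (_*ᴹ_ F c d) e ⟫ ≡ ⟪ v *ᵀ d , c ⟫ ⊕ ⟪ v , e ⟫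
  ⟪⟫-affine v c d e =
    trans (dot-zipWith {_∙_ = zipWith _⊕_} (dot-zipWith R.distribˡ) v (_*ᴹ_ F c d) e) (cong (_⊕ ⟪ v , e ⟫) (⟪⟫-adjoint v c d))

  -- Fibres of d ↦ v dᵀ

  ·-zeroʳ : ∀ {n} (d : Vec Carrier n) → d · replicate n 0# ≡ 0#
  ·-zeroʳ []      = refl
  ·-zeroʳ (x ∷ d) = trans (cong₂ _⊕_ (R.zeroʳ x) (·-zeroʳ d)) (R.+-identityˡ 0#)

  -- Equidistribution of y against the zero vector, with u as the shift on the side of zero.
  hyperplane-card : ∀ {n} {y : Vec Carrier n} → ¬ y ≡ replicate n 0# → ∀ u →
    q * ∑ (elems (Row n)) (λ d → 𝟙 ((d · y) ≟ᶠ u)) ≡ card (Row n)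
  hyperplane-card {n} {y} y≢0 u = trans
    (cong (q *_) (∑-cong (λ d → cong₂ (λ a b → 𝟙 (a ≟ᶠ b))
      (sym (R.+-identityˡ (d · y)))
      (sym (trans (cong (u ⊕_) (·-zeroʳ d)) (R.+-identityʳ u)))) (elems (Row n))))
    (dot-equidistributed {E = Fq} ⊗-equidistributed n y≢0 0# u)

  -- The m conditions concern different rows of d, so the count factors into m hyperplane counts,
  -- each saving a factor q.
  hyperplanes-card : ∀ {n} {y : Vec Carrier n} → ¬ y ≡ replicate n 0# → ∀ {m} (u : Vec Carrier m) →
    q ^ m * ∑ (elems (Vec-enumeration (Row n) m)) (λ d → 𝟙 (≡-dec _≟ᶠ_ (tabulate λ k → lookup d k · y) u))
      ≡ card (Vec-enumeration (Row n) m)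
  hyperplanes-card y≢0 [] = refl
  hyperplanes-card {n} {y} y≢0 {suc m} (u ∷ us) = begin
    q * q ^ m * ∑ (cartesianProductWith _∷_ ds dss) (λ d → 𝟙 (≡-dec _≟ᶠ_ (tabulate λ k → lookup d k · y) (u ∷ us)))
      ≡⟨ cong (q * q ^ m *_) (∑-cartesianProductWith _∷_ _ ds dss) ⟩
    q * q ^ m * ∑ ds (λ d → ∑ dss λ d′ → 𝟙 (≡-dec _≟ᶠ_ (d · y ∷ image d′) (u ∷ us)))
      ≡⟨ cong (q * q ^ m *_) (∑-cong (λ d → ∑-cong (λ d′ →
           𝟙-× ((d · y) ≟ᶠ u) (≡-dec _≟ᶠ_ (image d′) us) (≡-dec _≟ᶠ_ (d · y ∷ image d′) (u ∷ us)) ∷-injective (cong₂ _∷_)) dss) ds) ⟩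
    q * q ^ m * ∑ ds (λ d → ∑ dss λ d′ → 𝟙 ((d · y) ≟ᶠ u) * 𝟙 (≡-dec _≟ᶠ_ (image d′) us))
      ≡⟨ cong (q * q ^ m *_) (∑-product _ _ ds dss) ⟨
    q * q ^ m * (∑ ds (λ d → 𝟙 ((d · y) ≟ᶠ u)) * ∑ dss λ d′ → 𝟙 (≡-dec _≟ᶠ_ (image d′) us))
      ≡⟨ interchange q (q ^ m) _ _ ⟩
    (q * ∑ ds (λ d → 𝟙 ((d · y) ≟ᶠ u))) * (q ^ m * ∑ dss λ d′ → 𝟙 (≡-dec _≟ᶠ_ (image d′) us))
      ≡⟨ cong₂ _*_ (hyperplane-card y≢0 u) (hyperplanes-card y≢0 us) ⟩
    length ds * length dss
      ≡⟨ length-cartesianProductWith _∷_ ds dss ⟨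
    length (cartesianProductWith _∷_ ds dss) ∎
    where
    open ≡-Reasoning
    ds  = elems (Row n)
    dss = elems (Vec-enumeration (Row n) m)
    image : Vec (Vec Carrier n) m → Vec Carrier m
    image d = tabulate λ k → lookup d k · y
    interchange : ∀ a b c d → a * b * (c * d) ≡ (a * c) * (b * d)
    interchange = solve-∀

  ≢replicate⇒∃ : DecidableEquality X → ∀ {x₀ : X} {m} (xs : Vec X m) → ¬ xs ≡ replicate m x₀ →
    ∃ λ i → ¬ lookup xs i ≡ x₀
  ≢replicate⇒∃ _≟_ []       ≢ = contradiction refl ≢
  ≢replicate⇒∃ _≟_ {x₀} (x ∷ xs) ≢ with x ≟ x₀
  ... | no  x≢   = zero , x≢
  ... | yes refl = let i , ≢i = ≢replicate⇒∃ _≟_ xs (≢ ∘ cong (x ∷_)) in suc i , ≢i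

  -- The energy bound for matrices

  module Matrices (n : ℕ) where

    Mₙ : Enumeration (Mat F n)
    Mₙ = Vec-enumeration (Row n) n

    open Enumeration Mₙ using (_≟_)

    0ᴹ : Mat F n
    0ᴹ = replicate n (replicate n 0#)

    -- Some row v_i is nonzero. Row i of v dᵀ = u alone imposes one hyperplane condition on each of
    -- the n rows of d; keeping only that row gives an upper bound.
    *ᵀ-fibre : ∀ {v} → ¬ v ≡ 0ᴹ → ∀ u → q ^ n * ∑ (elems Mₙ) (λ d → 𝟙 ((v *ᵀ d) ≟ u)) ≤ card Mₙ
    *ᵀ-fibre {v} v≢0 u = begin
      q ^ n * ∑ (elems Mₙ) (λ d → 𝟙 ((v *ᵀ d) ≟ u))
        ≤⟨ *-monoʳ-≤ (q ^ n) (∑-mono (λ d → 𝟙-mono ((v *ᵀ d) ≟ u) (≡-dec _≟ᶠ_ (tabulate λ k → lookup d k · lookup v i) (lookup u i))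
             (λ eq → trans (sym (lookup∘tabulate _ i)) (cong (λ x → lookup x i) eq))) (elems Mₙ)) ⟩
      q ^ n * ∑ (elems Mₙ) (λ d → 𝟙 (≡-dec _≟ᶠ_ (tabulate λ k → lookup d k · lookup v i) (lookup u i)))
        ≡⟨ hyperplanes-card vᵢ≢0 (lookup u i) ⟩
      card Mₙ ∎
      where
      open ≤-Reasoning
      i    = proj₁ (≢replicate⇒∃ (≡-dec _≟ᶠ_) v v≢0)
      vᵢ≢0 = proj₂ (≢replicate⇒∃ (≡-dec _≟ᶠ_) v v≢0)

    card-Mₙ : card Mₙ ≡ q ^ (n * n)
    card-Mₙ = begin
      card Mₙ          ≡⟨ card-Vec (Row n) n ⟩
      card (Row n) ^ n ≡⟨ cong (_^ n) (trans (card-Vec Fq n) (cong (_^ n) card-Fq)) ⟩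
      (q ^ n) ^ n      ≡⟨ ^-*-assoc q n n ⟩
      q ^ (n * n)      ∎
      where open ≡-Reasoning

    instance
      card-Mₙ≢0 : NonZero (card Mₙ)
      card-Mₙ≢0 = subst NonZero (sym card-Mₙ) (m^n≢0 q (n * n))

    affine : Mat F n → Mat F n × Mat F n → Mat F n
    affine d (c , e) = _+ᴹ_ F (_*ᴹ_ F c d) e

    energy : List (Mat F n × Mat F n) → ℕ
    energy P = ∑ (elems Mₙ) λ d → collisions Mₙ P (affine d)

    ⟪⟫-equidistributed : Equidistributed Mₙ ⟪_,_⟫
    ⟪⟫-equidistributed = dot-equidistributed {E = Row n} (dot-equidistributed {E = Fq} ⊗-equidistributed n) n

    module _ (P : List (Mat F n × Mat F n)) where

      S : Mat F n → Mat F n → ℕ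
      S u v = excess P λ (c , e) → ⟪ u , c ⟫ ⊕ ⟪ v , e ⟫

      -- Plancherel on the space of pairs of matrices, applied to the identity map, whose collisions
      -- are the coincidences within P.
      ∑∑-S : ∑ (elems Mₙ) (λ v → ∑ (elems Mₙ) λ u → S u v)
               ≡ pred q * (card Mₙ * card Mₙ * collisions (×-enumeration Mₙ Mₙ) P id)
      ∑∑-S = begin
        ∑ (elems Mₙ) (λ v → ∑ (elems Mₙ) λ u → S u v)
          ≡⟨ ∑-swap (λ v u → S u v) (elems Mₙ) (elems Mₙ) ⟩
        ∑ (elems Mₙ) (λ u → ∑ (elems Mₙ) λ v → S u v)
          ≡⟨ ∑-cartesianProductWith _,_ (uncurry S) (elems Mₙ) (elems Mₙ) ⟨
        ∑ (elems (×-enumeration Mₙ Mₙ)) (uncurry S)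
          ≡⟨ ∑-excess {E = ×-enumeration Mₙ Mₙ}
               (×-equidistributed {EX = Mₙ} {EY = Mₙ} ⟪⟫-equidistributed ⟪⟫-equidistributed) P id ⟩
        pred q * (card (×-enumeration Mₙ Mₙ) * collisions (×-enumeration Mₙ Mₙ) P id)
          ≡⟨ cong (λ k → pred q * (k * collisions (×-enumeration Mₙ Mₙ) P id))
                  (length-cartesianProductWith _,_ (elems Mₙ) (elems Mₙ)) ⟩
        pred q * (card Mₙ * card Mₙ * collisions (×-enumeration Mₙ Mₙ) P id) ∎
        where open ≡-Reasoning

      -- Plancherel for the map (c , e) ↦ c d + e with d fixed, its forms rewritten by adjointness.
      ∑-S-affine : ∀ d → ∑ (elems Mₙ) (λ v → S (v *ᵀ d) v) ≡ pred q * (card Mₙ * collisions Mₙ P (affine d))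
      ∑-S-affine d = trans
        (∑-cong (λ v → cong (λ k → q * k ∸ length P * length P)
          (collisions-cong Fq (λ (c , e) → sym (⟪⟫-affine v c d e)) P)) (elems Mₙ))
        (∑-excess {E = Mₙ} ⟪⟫-equidistributed P (affine d))

      -- For v = 0 the form vanishes for every d, so the trivial bound on the excess is used. For v
      -- ≠ 0 the matrices d are grouped by u = v dᵀ. The indicator merges both cases, so the trivial
      -- bound is charged once in a sum over v.
      ∑-S-*ᵀ : ∀ v → q ^ n * ∑ (elems Mₙ) (λ d → S (v *ᵀ d) v)
                 ≤ 𝟙 (0ᴹ ≟ v) * (q ^ n * (card Mₙ * (pred q * (length P * length P))))
                     + card Mₙ * ∑ (elems Mₙ) λ u → S u v
      ∑-S-*ᵀ v with 0ᴹ ≟ v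
      ... | yes _ = begin
        q ^ n * ∑ (elems Mₙ) (λ d → S (v *ᵀ d) v)
          ≤⟨ *-monoʳ-≤ (q ^ n) (∑-mono (λ d → excess≤ P _) (elems Mₙ)) ⟩
        q ^ n * ∑ (elems Mₙ) (λ _ → pred q * (length P * length P))
          ≡⟨ cong (q ^ n *_) (∑-const (elems Mₙ) _) ⟩
        q ^ n * (card Mₙ * (pred q * (length P * length P)))
          ≡⟨ *-identityˡ _ ⟨
        1 * (q ^ n * (card Mₙ * (pred q * (length P * length P))))
          ≤⟨ m≤m+n _ _ ⟩
        1 * (q ^ n * (card Mₙ * (pred q * (length P * length P)))) + card Mₙ * ∑ (elems Mₙ) (λ u → S u v) ∎
        where open ≤-Reasoning
      ... | no 0≢v = begin
        q ^ n * ∑ (elems Mₙ) (λ d → S (v *ᵀ d) v)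
          ≡⟨ cong (q ^ n *_) (∑-cong (λ d → Enumeration.∑-δ Mₙ (λ u → S u v) (v *ᵀ d)) (elems Mₙ)) ⟨
        q ^ n * ∑ (elems Mₙ) (λ d → ∑ (elems Mₙ) λ u → 𝟙 ((v *ᵀ d) ≟ u) * S u v)
          ≡⟨ cong (q ^ n *_) (∑-swap _ (elems Mₙ) (elems Mₙ)) ⟩
        q ^ n * ∑ (elems Mₙ) (λ u → ∑ (elems Mₙ) λ d → 𝟙 ((v *ᵀ d) ≟ u) * S u v)
          ≡⟨ ∑-*ˡ (q ^ n) _ (elems Mₙ) ⟨
        ∑ (elems Mₙ) (λ u → q ^ n * ∑ (elems Mₙ) λ d → 𝟙 ((v *ᵀ d) ≟ u) * S u v)
          ≡⟨ ∑-cong (λ u → trans (cong (q ^ n *_) (∑-*ʳ (S u v) _ (elems Mₙ))) (sym (*-assoc (q ^ n) _ (S u v)))) (elems Mₙ) ⟩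
        ∑ (elems Mₙ) (λ u → q ^ n * ∑ (elems Mₙ) (λ d → 𝟙 ((v *ᵀ d) ≟ u)) * S u v)
          ≤⟨ ∑-mono (λ u → *-monoˡ-≤ (S u v) (*ᵀ-fibre (0≢v ∘ sym) u)) (elems Mₙ) ⟩
        ∑ (elems Mₙ) (λ u → card Mₙ * S u v)
          ≡⟨ ∑-*ˡ (card Mₙ) _ (elems Mₙ) ⟩
        card Mₙ * ∑ (elems Mₙ) (λ u → S u v) ∎
        where open ≤-Reasoning

      -- After multiplication by (q - 1) Q, the energy becomes the sum of S(v dᵀ , v) over d and v.
      -- Bounding it for each v leaves one term from v = 0 and the full sum of S(u , v).
      energy-bound : Unique P →
        q ^ n * energy P ≤ q ^ n * (length P * length P) + card Mₙ * card Mₙ * length P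
      energy-bound uniqueP = *-cancelˡ-≤ (pred q * Q) {{m*n≢0 (pred q) Q}} (begin
        pred q * Q * (q ^ n * energy P)
          ≡⟨ pull (pred q) Q (q ^ n) (energy P) ⟩
        q ^ n * (pred q * (Q * energy P))
          ≡⟨ cong (q ^ n *_) (trans (cong (pred q *_) (sym (∑-*ˡ Q _ Ms))) (sym (∑-*ˡ (pred q) _ Ms))) ⟩
        q ^ n * ∑ Ms (λ d → pred q * (Q * collisions Mₙ P (affine d)))
          ≡⟨ cong (q ^ n *_) (trans (∑-cong (λ d → sym (∑-S-affine d)) Ms) (∑-swap _ Ms Ms)) ⟩
        q ^ n * ∑ Ms (λ v → ∑ Ms λ d → S (v *ᵀ d) v)
          ≡⟨ ∑-*ˡ (q ^ n) _ Ms ⟨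
        ∑ Ms (λ v → q ^ n * ∑ Ms λ d → S (v *ᵀ d) v)
          ≤⟨ ∑-mono ∑-S-*ᵀ Ms ⟩
        ∑ Ms (λ v → 𝟙 (0ᴹ ≟ v) * T + Q * ∑ Ms λ u → S u v)
          ≡⟨ ∑-+ _ _ Ms ⟩
        ∑ Ms (λ v → 𝟙 (0ᴹ ≟ v) * T) + ∑ Ms (λ v → Q * ∑ Ms λ u → S u v)
          -- Only v = 0 contributes `T`; this becomes the main term with p².
          ≡⟨ cong₂ _+_ (Enumeration.∑-δ Mₙ (λ _ → T) 0ᴹ) (trans (∑-*ˡ Q _ Ms) (cong (Q *_) ∑∑-S)) ⟩
        T + Q * (pred q * (Q * Q * collisions (×-enumeration Mₙ Mₙ) P id))
          -- As P has no repetitions, the identity map collides only on the diagonal of P × P.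
          ≤⟨ +-monoʳ-≤ T (*-monoʳ-≤ Q (*-monoʳ-≤ (pred q) (*-monoʳ-≤ (Q * Q) (unique⇒collisions≤length (×-enumeration Mₙ Mₙ) uniqueP)))) ⟩
        T + Q * (pred q * (Q * Q * p))
          ≡⟨ factor (pred q) Q (q ^ n) p ⟩
        pred q * Q * (q ^ n * (p * p) + Q * Q * p) ∎)
        where
        open ≤-Reasoning
        Ms = elems Mₙ
        Q  = card Mₙ
        p  = length P
        T  = q ^ n * (Q * (pred q * (p * p)))
        pull : ∀ a b c d → a * b * (c * d) ≡ c * (a * (b * d))
        pull = solve-∀
        factor : ∀ a b c p → c * (b * (a * (p * p))) + b * (a * (b * b * p)) ≡ a * b * (c * (p * p) + b * b * p)
        factor = solve-∀

      -- From energy to incidences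

      dev : Mat F n → Mat F n → ℕ
      dev d b = deviation Mₙ P (affine d) b

      -- Sum the variance identity over d. The squared means total Q² p², which is exactly the main
      -- term of the energy bound times Q² / qⁿ, so the two cancel and only the error term remains.
      ∑-dev²-bound : Unique P →
        q ^ n * ∑ (elems Mₙ) (λ d → ∑ (elems Mₙ) λ b → dev d b * dev d b) ≤ card Mₙ ^ 4 * length P
      ∑-dev²-bound uniqueP = +-cancelʳ-≤ (q ^ n * (Q * (Q * (p * p)))) _ _ (begin
        q ^ n * V + q ^ n * (Q * (Q * (p * p)))
          ≡⟨ *-distribˡ-+ (q ^ n) V _ ⟨
        q ^ n * (V + Q * (Q * (p * p)))
          ≡⟨ cong (λ k → q ^ n * (V + k)) (∑-const Ms _) ⟨
        q ^ n * (V + ∑ Ms (λ _ → Q * (p * p)))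
          ≡⟨ cong (q ^ n *_) (∑-+ _ _ Ms) ⟨
        q ^ n * ∑ Ms (λ d → ∑ Ms (λ b → dev d b * dev d b) + Q * (p * p))
          ≡⟨ cong (q ^ n *_) (trans (∑-cong (λ d → ∑-deviation² Mₙ P (affine d)) Ms) (∑-*ˡ (Q * Q) _ Ms)) ⟩
        q ^ n * (Q * Q * energy P)
          ≡⟨ pull (q ^ n) (Q * Q) (energy P) ⟩
        Q * Q * (q ^ n * energy P)
          ≤⟨ *-monoʳ-≤ (Q * Q) (energy-bound uniqueP) ⟩
        Q * Q * (q ^ n * (p * p) + Q * Q * p)
          ≡⟨ expand Q (q ^ n) p ⟩
        Q ^ 4 * p + q ^ n * (Q * (Q * (p * p))) ∎)
        where
        open ≤-Reasoning
        Ms = elems Mₙ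
        Q  = card Mₙ
        p  = length P
        V  = ∑ Ms (λ d → ∑ Ms λ b → dev d b * dev d b)
        pull : ∀ a b c → a * (b * c) ≡ b * (a * c)
        pull = solve-∀
        expand : ∀ Q c p → Q * Q * (c * (p * p) + Q * Q * p) ≡ Q * (Q * (Q * (Q * 1))) * p + c * (Q * (Q * (p * p)))
        expand = solve-∀

      incidences : (B D : List (Mat F n)) → ℕ
      incidences B D = ∑ D λ d → ∑ B λ b → fibre Mₙ P (affine d) b

      total-deviation : (B D : List (Mat F n)) → ℕ
      total-deviation B D = ∑ D λ d → ∑ B λ b → dev d b

      -- Each scaled fibre size is at most p plus its deviation.
      incidences-bound : ∀ B D →
        card Mₙ * incidences B D ≤ length D * length B * length P + total-deviation B D
      incidences-bound B D = begin
        card Mₙ * incidences B D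
          ≡⟨ trans (sym (∑-*ˡ (card Mₙ) _ D)) (∑-cong (λ d → sym (∑-*ˡ (card Mₙ) _ B)) D) ⟩
        ∑ D (λ d → ∑ B λ b → card Mₙ * fibre Mₙ P (affine d) b)
          ≤⟨ ∑-mono (λ d → ∑-mono (λ b → m≤n+∣m-n∣ (card Mₙ * fibre Mₙ P (affine d) b) (length P)) B) D ⟩
        ∑ D (λ d → ∑ B λ b → length P + dev d b)
          ≡⟨ ∑-cong (λ d → trans (∑-+ _ _ B) (cong (_+ ∑ B (dev d)) (∑-const B (length P)))) D ⟩
        ∑ D (λ d → length B * length P + ∑ B (dev d))
          ≡⟨ trans (∑-+ _ _ D) (cong (_+ total-deviation B D) (∑-const D _)) ⟩
        length D * (length B * length P) + total-deviation B D
          ≡⟨ cong (_+ total-deviation B D) (*-assoc (length D) _ _) ⟨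
        length D * length B * length P + total-deviation B D ∎
        where open ≤-Reasoning

      -- Cauchy-Schwarz over D × B; the sum of squares is then enlarged to all pairs of matrices, as
      -- B and D have no repetitions.
      total-deviation-bound : Unique P → ∀ {B D} → Unique B → Unique D →
        q ^ n * (total-deviation B D * total-deviation B D) ≤ length D * length B * (card Mₙ ^ 4 * length P)
      total-deviation-bound uniqueP {B} {D} uniqueB uniqueD = begin
        q ^ n * (total-deviation B D * total-deviation B D)
          ≡⟨ cong (λ k → q ^ n * (k * k)) (∑-cartesianProductWith _,_ (uncurry dev) D B) ⟨
        q ^ n * (∑ DB (uncurry dev) * ∑ DB (uncurry dev))
          ≤⟨ *-monoʳ-≤ (q ^ n) (cauchy-schwarz (uncurry dev) DB) ⟩
        q ^ n * (length DB * ∑ DB (λ (d , b) → dev d b * dev d b))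
          ≡⟨ cong₂ (λ k l → q ^ n * (k * l)) (length-cartesianProductWith _,_ D B) (∑-cartesianProductWith _,_ _ D B) ⟩
        q ^ n * (length D * length B * ∑ D (λ d → ∑ B λ b → dev d b * dev d b))
          ≡⟨ pull (q ^ n) (length D * length B) _ ⟩
        length D * length B * (q ^ n * ∑ D (λ d → ∑ B λ b → dev d b * dev d b))
          ≤⟨ *-monoʳ-≤ (length D * length B) (*-monoʳ-≤ (q ^ n)
               (≤-trans (∑-mono (λ d → Enumeration.∑-subset Mₙ _ uniqueB) D) (Enumeration.∑-subset Mₙ _ uniqueD))) ⟩
        length D * length B * (q ^ n * ∑ (elems Mₙ) (λ d → ∑ (elems Mₙ) λ b → dev d b * dev d b))
          ≤⟨ *-monoʳ-≤ (length D * length B) (∑-dev²-bound uniqueP) ⟩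
        length D * length B * (card Mₙ ^ 4 * length P) ∎
        where
        open ≤-Reasoning
        DB = cartesianProduct D B
        pull : ∀ a b c → a * (b * c) ≡ b * (a * c)
        pull = solve-∀

    -- Solutions as incidences

    negᴹ : Mat F n → Mat F n
    negᴹ = Vec.map (Vec.map -_)

    negᴹ-injective : ∀ {a a′} → negᴹ a ≡ negᴹ a′ → a ≡ a′
    negᴹ-injective = map-injective (map-injective ⁻¹-injective)

    x⊕y≡z⇒z-x≡y : ∀ x y z → x ⊕ y ≡ z → z ⊕ - x ≡ y
    x⊕y≡z⇒z-x≡y x y z refl = trans (R.+-comm _ (- x)) (\\-leftDividesʳ x y)

    z-x≡y⇒x⊕y≡z : ∀ x y z → z ⊕ - x ≡ y → x ⊕ y ≡ z
    z-x≡y⇒x⊕y≡z x y z refl = trans (R.+-comm x _) (//-rightDividesˡ x z)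

    -- Rewrite a + b = c d as c d + (-a) = b and reorder the sums so that d and b are outermost.
    countSol≡incidences : ∀ A B C D →
      countSol F n A B C D ≡ incidences (cartesianProduct C (List.map negᴹ A)) B D
    countSol≡incidences A B C D = begin
      ∑ A (λ a → ∑ B λ b → ∑ C λ c → ∑ D λ d → h a b c d)
        ≡⟨ ∑-cong (λ a → ∑-cong (λ b → ∑-swap _ C D) B) A ⟩
      ∑ A (λ a → ∑ B λ b → ∑ D λ d → ∑ C λ c → h a b c d)
        ≡⟨ ∑-cong (λ a → ∑-swap _ B D) A ⟩
      ∑ A (λ a → ∑ D λ d → ∑ B λ b → ∑ C λ c → h a b c d)
        ≡⟨ ∑-swap _ A D ⟩
      ∑ D (λ d → ∑ A λ a → ∑ B λ b → ∑ C λ c → h a b c d)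
        ≡⟨ ∑-cong (λ d → trans (∑-swap _ A B) (∑-cong (λ b → ∑-swap _ A C) B)) D ⟩
      ∑ D (λ d → ∑ B λ b → ∑ C λ c → ∑ A λ a → h a b c d)
        ≡⟨ ∑-cong (λ d → ∑-cong (λ b → ∑-cong (λ c → ∑-cong (λ a →
             𝟙-cong (_≟ᴹ_ F _ _) (affine d (c , negᴹ a) ≟ b) (forward a b _) (backward a b _)) A) C) B) D ⟩
      ∑ D (λ d → ∑ B λ b → ∑ C λ c → ∑ A λ a → 𝟙 (affine d (c , negᴹ a) ≟ b))
        ≡⟨ ∑-cong (λ d → ∑-cong (λ b → trans (∑-cartesianProductWith _,_ _ C (List.map negᴹ A))
             (∑-cong (λ c → ∑-map negᴹ _ A) C)) B) D ⟨
      incidences (cartesianProduct C (List.map negᴹ A)) B D ∎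
      where
      open ≡-Reasoning
      h : Mat F n → Mat F n → Mat F n → Mat F n → ℕ
      h a b c d = 𝟙 (_≟ᴹ_ F (_+ᴹ_ F a b) (_*ᴹ_ F c d))
      forward : ∀ (a b x : Mat F n) → _+ᴹ_ F a b ≡ x → _+ᴹ_ F x (negᴹ a) ≡ b
      forward = zipWith-solve (zipWith-solve x⊕y≡z⇒z-x≡y)
      backward : ∀ (a b x : Mat F n) → _+ᴹ_ F x (negᴹ a) ≡ b → _+ᴹ_ F a b ≡ x
      backward = zipWith-unsolve (zipWith-unsolve z-x≡y⇒x⊕y≡z)

-- Final arithmetic

-- Whichever of the main term and the deviation V is larger, Q N is at most twice it; the two cases
-- give the two alternatives.
arithmetic : ∀ n q N a b c d V → .{{_ : NonZero q}} → 1 ≤ n → let Q = q ^ (n * n) in b ≤ Q →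
  Q * N ≤ d * b * (c * a) + V → q ^ n * (V * V) ≤ d * b * (Q ^ 4 * (c * a)) →
  (N ^ 2 * q ^ (n * n) ≤ 2 ^ 2 * (a ^ 2 * b * c ^ 2 * d ^ 2))
    ⊎ (N ^ 4 * q ^ (n + 1) ≤ 2 ^ 4 * q ^ (4 * (n * n)) * (a * b * c * d) ^ 2)
arithmetic n q N a b c d V 1≤n b≤Q QN≤ V²≤ with ≤-total V (d * b * (c * a))
... | inj₁ V≤ = inj₁ (*-cancelˡ-≤ Q {{m^n≢0 q (n * n)}} (begin
  Q * (N ^ 2 * Q)                              ≡⟨ square N Q ⟩
  (Q * N) * (Q * N)                            ≤⟨ *-mono-≤ QN≤2M QN≤2M ⟩
  (M + M) * (M + M)                            ≡⟨ expand a b c d ⟩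
  -- Of the two factors b in the squared main term, one is traded for Q; this leaves |B| to the
  -- power 1/2 in the bound.
  b * (2 ^ 2 * (a ^ 2 * b * c ^ 2 * d ^ 2))    ≤⟨ *-monoˡ-≤ _ b≤Q ⟩
  Q * (2 ^ 2 * (a ^ 2 * b * c ^ 2 * d ^ 2))    ∎))
  where
  open ≤-Reasoning
  Q = q ^ (n * n)
  M = d * b * (c * a)
  QN≤2M : Q * N ≤ M + M
  QN≤2M = ≤-trans QN≤ (+-monoʳ-≤ M V≤)
  square : ∀ N Q → Q * (N * (N * 1) * Q) ≡ (Q * N) * (Q * N)
  square = solve-∀
  expand : ∀ a b c d → (d * b * (c * a) + d * b * (c * a)) * (d * b * (c * a) + d * b * (c * a))
    ≡ b * (4 * (a * (a * 1) * b * (c * (c * 1)) * (d * (d * 1))))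
  expand = solve-∀
... | inj₂ ≤V = inj₂ (begin
  -- The argument saves q^(n/2) in the error term, hence q^(2n) after fourth powers; n + 1 ≤ 2n
  -- since n ≥ 1.
  N ^ 4 * q ^ (n + 1)                               ≤⟨ *-monoʳ-≤ (N ^ 4) (^-monoʳ-≤ q (+-monoʳ-≤ n 1≤n)) ⟩
  N ^ 4 * q ^ (n + n)                               ≡⟨ cong (N ^ 4 *_) (^-distribˡ-+-* q n n) ⟩
  N ^ 4 * (q ^ n * q ^ n)                           ≡⟨ square² N (q ^ n) ⟩
  (N * N * q ^ n) * (N * N * q ^ n)                 ≤⟨ *-mono-≤ N²qⁿ≤ N²qⁿ≤ ⟩
  (4 * M * (Q * Q)) * (4 * M * (Q * Q))             ≡⟨ expand a b c d Q ⟩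
  2 ^ 4 * Q ^ 4 * (a * b * c * d) ^ 2               ≡⟨ cong (λ k → 2 ^ 4 * k * (a * b * c * d) ^ 2)
                                                         (trans (^-*-assoc q (n * n) 4) (cong (q ^_) (*-comm (n * n) 4))) ⟩
  2 ^ 4 * q ^ (4 * (n * n)) * (a * b * c * d) ^ 2   ∎)
  where
  open ≤-Reasoning
  Q = q ^ (n * n)
  M = d * b * (c * a)
  QN≤2V : Q * N ≤ V + V
  QN≤2V = ≤-trans QN≤ (+-monoˡ-≤ V ≤V)
  instance
    Q≢0 : NonZero Q
    Q≢0 = m^n≢0 q (n * n)
  gather : ∀ N Q c → Q * Q * (N * N * c) ≡ c * ((Q * N) * (Q * N))
  gather = solve-∀
  scale : ∀ c V → c * ((V + V) * (V + V)) ≡ 4 * (c * (V * V))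
  scale = solve-∀
  regroup : ∀ k p Q → 4 * (k * (Q * (Q * (Q * (Q * 1))) * p)) ≡ Q * Q * (4 * (k * p) * (Q * Q))
  regroup = solve-∀
  N²qⁿ≤ : N * N * q ^ n ≤ 4 * M * (Q * Q)
  N²qⁿ≤ = *-cancelˡ-≤ (Q * Q) {{m*n≢0 Q Q}} (begin
    Q * Q * (N * N * q ^ n)            ≡⟨ gather N Q (q ^ n) ⟩
    q ^ n * ((Q * N) * (Q * N))        ≤⟨ *-monoʳ-≤ (q ^ n) (*-mono-≤ QN≤2V QN≤2V) ⟩
    q ^ n * ((V + V) * (V + V))        ≡⟨ scale (q ^ n) V ⟩
    4 * (q ^ n * (V * V))              ≤⟨ *-monoʳ-≤ 4 V²≤ ⟩
    4 * (d * b * (Q ^ 4 * (c * a)))    ≡⟨ regroup (d * b) (c * a) Q ⟩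
    Q * Q * (4 * M * (Q * Q))          ∎)
  square² : ∀ N c → N * (N * (N * (N * 1))) * (c * c) ≡ (N * N * c) * (N * N * c)
  square² = solve-∀
  expand : ∀ a b c d Q → (4 * (d * b * (c * a)) * (Q * Q)) * (4 * (d * b * (c * a)) * (Q * Q))
    ≡ 16 * (Q * (Q * (Q * (Q * 1)))) * ((a * b * c * d) * ((a * b * c * d) * 1))
  expand = solve-∀

-- A bound by K times a sum of two terms amounts, up to a factor 2 in K, to a bound by K times one
-- of them. The alternatives are these two bounds, squared and raised to the fourth power
-- respectively, which clears roots and denominators.
theorem4p4 : (n : ℕ) → 1 ≤ n → Σ ℕ λ K →
    (F : FiniteField) → (A B C D : List (Mat F n)) →
    Unique A → Unique B → Unique C → Unique D →
    let q = FiniteField.size F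
        N = countSol F n A B C D
        a = length A
        b = length B
        c = length C
        d = length D
    in (N ^ 2 * q ^ (n * n) ≤ K ^ 2 * (a ^ 2 * b * c ^ 2 * d ^ 2))
       ⊎ (N ^ 4 * q ^ (n + 1) ≤ K ^ 4 * q ^ (4 * (n * n)) * (a * b * c * d) ^ 2)
theorem4p4 n 1≤n = 2 , bound
  where
  bound : (F : FiniteField) → (A B C D : List (Mat F n)) →
    Unique A → Unique B → Unique C → Unique D → _
  bound F A B C D uA uB uC uD =
    arithmetic n q (countSol F n A B C D) (length A) (length B) (length C) (length D) V 1≤n
      (subst (length B ≤_) card-Mₙ (Enumeration.length-unique≤card Mₙ uB))
      (subst₂ (λ Q p → Q * countSol F n A B C D ≤ length D * length B * p + V) card-Mₙ |P|
        (subst (λ N → card Mₙ * N ≤ length D * length B * length P + V) (sym (countSol≡incidences A B C D))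
          (incidences-bound P B D)))
      (subst₂ (λ Q p → q ^ n * (V * V) ≤ length D * length B * (Q ^ 4 * p)) card-Mₙ |P|
        (total-deviation-bound P uniqueP uB uD))
    where
    open Field F
    open Matrices n
    open FiniteField F using () renaming (size to q)
    P = cartesianProduct C (List.map negᴹ A)
    V = total-deviation P B D
    uniqueP : Unique P
    uniqueP = Unique.cartesianProduct⁺ uC (Unique.map⁺ negᴹ-injective uA)
    |P| : length P ≡ length C * length A
    |P| = trans (length-cartesianProductWith _,_ C (List.map negᴹ A)) (cong (length C *_) (length-map negᴹ A))
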